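{- There is an algorithm which, given integers $m\ge 1$ and $k \ge 1$, generates a multiversal cycle for the unlabeled binary words $U(m)$ of multiplicity $r = km$ and takes amortized $\mathcal{O}(1)$-time to generate each bit.
   Context: Let $B(m)$ be the set of binary words of length $m$, and for $w\in B(m)$ let $\overline{w}$ be its bitwise complement. $U(m)$ denotes any set containing exactly one representative of each of the $2^{m-1}$ pairs $\{w,\overline{w}\}$. A multiversal cycle of $U(m)$ of multiplicity $r$ is a binary sequence $S = s_0 s_1\cdots s_{|S|-1}$ (indices modulo $|S|$) with $|S| = r\cdot 2^{m-1}$ such that for every $0 \le j < r$ the set of words $\{\, s_{j+tr}\, s_{j+tr+1}\cdots s_{j+tr+m-1} : 0 \le t < 2^{m-1} \,\}$ contains exactly one word from each pair $\{w,\overline{w}\}$, $w\in B(m)$. Generating $S$ means outputting its bits $s_0,s_1,\ldots$ one after another; amortized $\mathcal{O}(1)$-time per bit means that the total running time is $\mathcal{O}(|S|)$, in the unit-cost RAM model. -}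

module Defs where

open import Data.Bool.Base using (Bool; true; false; not; if_then_else_)
open import Data.Fin.Base using (Fin; toℕ)
open import Data.List.Base using (List; []; _∷_; [_]; _++_; head; drop; map)
open import Data.Maybe.Base using (just; nothing)
open import Data.Nat.Base using (ℕ; zero; suc; _+_; _*_; _∸_; _^_; NonZero)
open import Data.Nat.DivMod using (_mod_)
open import Data.Nat.Properties using (_≟_; m*n≢0; m^n≢0)
open import Data.Product.Base using (_×_; ∃-syntax)
open import Data.Sum.Base using (_⊎_)
open import Data.Vec.Base using (Vec; lookup; tabulate)
open import Function.Base using (it)
open import Level using (0ℓ)
open import Relation.Binary.PropositionalEquality using (_≡_)
open import Relation.Nullary using (does)
open import Relation.Unary using (Pred; _∈_; _∉_)

import Data.Vec.Base as Vec

B : ℕ → Set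
B = Vec Bool

complement : ∀ {m} → B m → B m
complement = Vec.map not

-- U meets every pair {w , complement w} in exactly one word, i.e. U is one of
-- the sets denoted U(m).
OnePerPair : ∀ {m} → Pred (B m) 0ℓ → Set
OnePerPair U = ∀ w → (w ∈ U × complement w ∉ U) ⊎ (w ∉ U × complement w ∈ U)

-- s_p s_{p+1} ⋯ s_{p+m-1}, indices taken modulo the length of the sequence.
window : ∀ {n} .{{_ : NonZero n}} → Vec Bool n → (m p : ℕ) → B m
window {n} s m p = tabulate λ i → lookup s ((p + toℕ i) mod n)

cycleLength : (m r : ℕ) → ℕ
cycleLength m r = r * 2 ^ (m ∸ 1)

-- The set of length-m words of s at the positions j + t r, 0 ≤ t < 2^(m-1).
phaseWords : (m r : ℕ) .{{_ : NonZero r}} →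
             Vec Bool (cycleLength m r) → Fin r → Pred (B m) 0ℓ
phaseWords m r s j w =
  ∃[ t ] w ≡ window {{m*n≢0 r _ {{it}} {{m^n≢0 2 (m ∸ 1)}}}} s m
                    (toℕ j + toℕ {2 ^ (m ∸ 1)} t * r)

IsMultiversalCycle : (m r : ℕ) .{{_ : NonZero r}} →
                     Vec Bool (cycleLength m r) → Set
IsMultiversalCycle m r s = ∀ j → OnePerPair (phaseWords m r s j)

-- The random access machine of Cook and Reckhow, with natural-number registers
-- X_0, X_1, … and truncated subtraction. Multiplication and bitwise operations
-- on registers are deliberately not primitive. Jump targets are absolute
-- program addresses, starting at 0.
data Instr : Set where
  const : (i c : ℕ)   → Instr   -- X_i ← c
  add   : (i j k : ℕ) → Instr   -- X_i ← X_j + X_k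
  sub   : (i j k : ℕ) → Instr   -- X_i ← X_j ∸ X_k
  load  : (i j : ℕ)   → Instr   -- X_i ← X_{X_j}
  store : (i j : ℕ)   → Instr   -- X_{X_i} ← X_j
  jpos  : (l j : ℕ)   → Instr   -- if X_j > 0 then go to l
  print : (j : ℕ)     → Instr   -- output X_j

Program : Set
Program = List Instr

Memory : Set
Memory = ℕ → ℕ

_[_≔_] : Memory → ℕ → ℕ → Memory
(x [ i ≔ v ]) a = if does (a ≟ i) then v else x a

record Config : Set where
  constructor ⟨_,_,_⟩
  field
    pc     : ℕ
    mem    : Memory
    output : List ℕ

open Config public

exec : Instr → Config → Config
exec (const i c)  ⟨ p , x , o ⟩ = ⟨ suc p , x [ i ≔ c ] , o ⟩
exec (add i j k)  ⟨ p , x , o ⟩ = ⟨ suc p , x [ i ≔ x j + x k ] , o ⟩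
exec (sub i j k)  ⟨ p , x , o ⟩ = ⟨ suc p , x [ i ≔ x j ∸ x k ] , o ⟩
exec (load i j)   ⟨ p , x , o ⟩ = ⟨ suc p , x [ i ≔ x (x j) ] , o ⟩
exec (store i j)  ⟨ p , x , o ⟩ = ⟨ suc p , x [ x i ≔ x j ] , o ⟩
exec (jpos l j)   ⟨ p , x , o ⟩ with x j
... | zero  = ⟨ suc p , x , o ⟩
... | suc _ = ⟨ l , x , o ⟩
exec (print j)    ⟨ p , x , o ⟩ = ⟨ suc p , x , o ++ [ x j ] ⟩

-- c runs to c′ in exactly t steps, every executed instruction costing one.
data _⊢_⟶[_]_ (P : Program) : Config → ℕ → Config → Set where
  stop : ∀ {c} → P ⊢ c ⟶[ 0 ] c
  step : ∀ {c c′ t I} → head (drop (pc c) P) ≡ just I →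
         P ⊢ exec I c ⟶[ t ] c′ → P ⊢ c ⟶[ suc t ] c′

-- The machine halts by leaving the program.
Halted : Program → Config → Set
Halted P c = head (drop (pc c) P) ≡ nothing

inputs : List ℕ → Memory
inputs []       _       = 0
inputs (a ∷ _)  zero    = a
inputs (_ ∷ as) (suc i) = inputs as i

start : List ℕ → Config
start as = ⟨ 0 , inputs as , [] ⟩

bit : Bool → ℕ
bit false = 0
bit true  = 1

Generates : Program → List ℕ → List Bool → ℕ → Set
Generates P as s t =
  ∃[ c ] (P ⊢ start as ⟶[ t ] c) × Halted P c × output c ≡ map bit s

{-# OPTIONS --safe #-}
-- Write m = n + 1. The cycle is the concatenation, over t = 0, …, 2^n ∸ 1, of k
-- copies of the word 0 b₀(t) … b_{n-1}(t), where b_i(t) is the i-th binary digit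
-- of t, least significant first. Every position divisible by m carries a 0, so
-- all words of phase j have a 0 at the place p with m ∣ j + p; conversely each
-- word with a 0 at that place occurs, because a digit of t + κ is determined by
-- the digits of t from the bottom up, whichever of t and t + 1 it is taken from.
-- The words with a 0 at a fixed place represent each pair exactly once.
-- The machine keeps the current word in memory, prints it k times and then
-- increments it as a binary counter, in O(km) + O(m) steps per value of t.
module Submission where

open import Defs
open import Data.Bool.Base using (Bool; true; false; not; if_then_else_; _xor_)
open import Data.Bool.Properties using (not-involutive)
open import Data.Empty using (⊥; ⊥-elim)
open import Data.Fin.Base using (Fin; toℕ; fromℕ<)
open import Data.Fin.Properties using (toℕ<n; toℕ-fromℕ<; toℕ-injective)
open import Data.List.Base using (List; []; _∷_; [_]; _++_; head; drop; map; applyUpTo)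
open import Data.List.Properties using (map-applyUpTo; applyUpTo-∷ʳ)
open import Data.Maybe.Base using (just)
open import Data.Nat.Base
  using (ℕ; zero; suc; _+_; _*_; _∸_; _^_; _≤_; _<_; z≤n; s≤s; ⌊_/2⌋; NonZero; >-nonZero⁻¹)
open import Data.Nat.DivMod
open import Data.Nat.Divisibility using (divides)
open import Data.Nat.Properties
open import Data.Nat.Tactic.RingSolver using (solve-∀)
open import Data.Product.Base using (_×_; _,_; ∃-syntax)
open import Data.Sum.Base using (inj₁; inj₂)
open import Data.Vec.Base using (Vec; lookup; tabulate; toList)
open import Data.Vec.Properties using (lookup∘tabulate; tabulate∘lookup; tabulate-cong; lookup-map)
open import Function.Base using (_∘_)
open import Relation.Binary.PropositionalEquality
  using (_≡_; _≢_; _≗_; refl; sym; trans; cong; cong₂; module ≡-Reasoning)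
open import Relation.Nullary using (does)

-- Binary digits and carries

odd : ℕ → Bool
odd zero    = false
odd (suc n) = not (odd n)

digit : ℕ → ℕ → Bool
digit v zero    = odd v
digit v (suc i) = digit ⌊ v /2⌋ i

-- The digits of v * 2 ^ i.
shifted : ℕ → ℕ → ℕ → Bool
shifted zero    v d       = digit v d
shifted (suc i) v zero    = false
shifted (suc i) v (suc d) = shifted i v d

odd-double+ : ∀ t x → odd (t + t + x) ≡ odd x
odd-double+ zero    x = refl
odd-double+ (suc t) x rewrite +-suc t t = trans (not-involutive _) (odd-double+ t x)

half-double+ : ∀ t x → ⌊ t + t + x /2⌋ ≡ t + ⌊ x /2⌋
half-double+ zero    x = refl
half-double+ (suc t) x rewrite +-suc t t = cong suc (half-double+ t x)

half-suc-even : ∀ v → odd v ≡ false → ⌊ suc v /2⌋ ≡ ⌊ v /2⌋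
half-suc-even zero          _ = refl
half-suc-even (suc (suc v)) p =
  cong suc (half-suc-even v (trans (sym (not-involutive _)) p))

suc-odd : ∀ v → odd v ≡ true → suc v ≡ suc ⌊ v /2⌋ * 2
suc-odd (suc zero)    _ = refl
suc-odd (suc (suc v)) p =
  cong (suc ∘ suc) (suc-odd v (trans (sym (not-involutive _)) p))

half-suc-odd : ∀ v → odd v ≡ true → ⌊ suc v /2⌋ ≡ suc ⌊ v /2⌋
half-suc-odd (suc zero)    _ = refl
half-suc-odd (suc (suc v)) p =
  cong suc (half-suc-odd v (trans (sym (not-involutive _)) p))

-- The summand `q * 2 ^ n` is even before each of the first `n` halvings. This wraps the counter
-- around where the cycle closes.
digit-periodic : ∀ n q a d → d < n → digit (q * 2 ^ n + a) d ≡ digit a d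
digit-periodic (suc n) q a d d<n with q * 2 ^ suc n | double q (2 ^ n)
  where
  double : ∀ q x → q * (2 * x) ≡ q * x + q * x
  double = solve-∀
digit-periodic (suc n) q a zero    d<n       | _ | refl = odd-double+ (q * 2 ^ n) a
digit-periodic (suc n) q a (suc d) (s≤s d<n) | _ | refl =
  trans (cong (λ x → digit x d) (half-double+ (q * 2 ^ n) a))
        (digit-periodic n q ⌊ a /2⌋ d d<n)

-- Adding the bit `b xor odd x` flips the parity of `x` exactly when it differs from `b`; `∃-digits`
-- picks its lowest digit this way.
bit-xor-odd : ∀ b x → odd (bit (b xor odd x) + x) ≡ b
bit-xor-odd b x with odd x in eq
bit-xor-odd true  x | true  = eq
bit-xor-odd true  x | false = cong not eq
bit-xor-odd false x | true  = cong not eq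
bit-xor-odd false x | false = eq

bit≤1 : ∀ b → bit b ≤ 1
bit≤1 true  = s≤s z≤n
bit≤1 false = z≤n

double+bit< : ∀ {t N} b → t < N → t + t + bit b < 2 * N
double+bit< {t} {N} b t<N = begin-strict
  t + t + bit b  ≤⟨ +-monoʳ-≤ (t + t) (bit≤1 b) ⟩
  t + t + 1      <⟨ n<1+n _ ⟩
  suc (t + t + 1) ≡⟨ eq t ⟩
  2 * suc t      ≤⟨ *-monoʳ-≤ 2 t<N ⟩
  2 * N          ∎
  where
  open ≤-Reasoning
  eq : ∀ t → suc (t + t + 1) ≡ 2 * suc t
  eq = solve-∀

-- The digits of t are chosen from the bottom up; the carry of each κ d + t out
-- of the lowest place is absorbed into κ.
∃-digits : ∀ n (a : ℕ → Bool) (κ : ℕ → ℕ) →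
           ∃[ t ] t < 2 ^ n × (∀ d → d < n → digit (t + κ d) d ≡ a d)
∃-digits zero    a κ = 0 , s≤s z≤n , λ _ ()
∃-digits (suc n) a κ
  with ∃-digits n (a ∘ suc) (λ d → ⌊ bit (a 0 xor odd (κ 0)) + κ (suc d) /2⌋)
... | t , t<2^n , digits = t + t + b , double+bit< (a 0 xor odd (κ 0)) t<2^n , digits′
  where
  b = bit (a 0 xor odd (κ 0))
  digits′ : ∀ d → d < suc n → digit (t + t + b + κ d) d ≡ a d
  digits′ zero    _         rewrite +-assoc (t + t) b (κ 0) =
    trans (odd-double+ t (b + κ 0)) (bit-xor-odd (a 0) (κ 0))
  digits′ (suc d) (s≤s d<n) rewrite +-assoc (t + t) b (κ (suc d)) =
    trans (cong (λ x → digit x d) (half-double+ t (b + κ (suc d)))) (digits d d<n)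

-- The cycle and its phases

toList-tabulate : ∀ {A : Set} n (f : ℕ → A) →
                  toList (tabulate {n = n} (f ∘ toℕ)) ≡ applyUpTo f n
toList-tabulate zero    f = refl
toList-tabulate (suc n) f = cong (f 0 ∷_) (toList-tabulate n (f ∘ suc))

-- Here `n` and `k` are the predecessors of the word length and of the number of copies, so both
-- divisors are visibly nonzero. `shifted 1` puts the leading 0 before the digits.
cycleBit : (n k q : ℕ) → Bool
cycleBit n k q = shifted 1 (q / (suc k * suc n)) (q % suc n)

cycle : ∀ n k → Vec Bool (cycleLength (suc n) (suc k * suc n))
cycle n k = tabulate (cycleBit n k ∘ toℕ)

module Cycle (n k : ℕ) where
  m r N L : ℕ
  m = suc n
  r = suc k * m
  N = 2 ^ n
  L = r * N

  instance
    N≢0 : NonZero N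
    N≢0 = m^n≢0 2 n
    L≢0 : NonZero L
    L≢0 = m*n≢0 r N

  f : ℕ → Bool
  f = cycleBit n k

  -- Since `m` divides `r`, a shift by `t * r` keeps the place inside the word and adds `t` to the
  -- counter. `ρ` is unbounded, so windows running into later blocks are covered.
  f-shift : ∀ t ρ → f (t * r + ρ) ≡ shifted 1 (t + ρ / r) (ρ % m)
  f-shift t ρ = cong₂ (shifted 1) quot rem
    where
    quot : (t * r + ρ) / r ≡ t + ρ / r
    quot = trans (+-distrib-/-∣ˡ ρ (divides t refl)) (cong (_+ ρ / r) (m*n/n≡m t r))
    rem : (t * r + ρ) % m ≡ ρ % m
    rem = trans (cong (_% m) (trans (+-comm (t * r) ρ)
                                    (cong (ρ +_) (sym (*-assoc t (suc k) m)))))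
                ([m+kn]%n≡m%n ρ (t * suc k) m)

  f-periodic : ∀ q ρ → f (q * L + ρ) ≡ f ρ
  f-periodic q ρ = begin
    f (q * L + ρ)                        ≡⟨ cong (λ x → f (x + ρ)) (regroup q r N) ⟩
    f (q * N * r + ρ)                    ≡⟨ f-shift (q * N) ρ ⟩
    shifted 1 (q * N + ρ / r) (ρ % m)    ≡⟨ cell-periodic (ρ % m) (m%n<n ρ m) ⟩
    f ρ                                  ∎
    where
    open ≡-Reasoning
    regroup : ∀ q r N → q * (r * N) ≡ q * N * r
    regroup = solve-∀
    cell-periodic : ∀ d → d < m → shifted 1 (q * N + ρ / r) d ≡ shifted 1 (ρ / r) d
    cell-periodic zero    _         = refl
    cell-periodic (suc d) (s≤s d<n) = digit-periodic n q (ρ / r) d d<n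

  lookup-cycle : ∀ p → lookup (cycle n k) (p mod L) ≡ f p
  lookup-cycle p = begin
    lookup (cycle n k) (p mod L) ≡⟨ lookup∘tabulate (f ∘ toℕ) (p mod L) ⟩
    f (toℕ (p mod L))            ≡⟨ cong f (toℕ-fromℕ< (m%n<n p L)) ⟩
    f (p % L)                    ≡⟨ f-periodic (p / L) (p % L) ⟨
    f (p / L * L + p % L)        ≡⟨ cong f (+-comm (p / L * L) (p % L)) ⟩
    f (p % L + p / L * L)        ≡⟨ cong f (m≡m%n+[m/n]*n p L) ⟨
    f p                          ∎
    where open ≡-Reasoning

  -- The form in which the machine meets the cycle: `v * m + i < r`, so the counter is still `t`.
  f-cell : ∀ t v i → v < suc k → i < m → f (t * r + v * m + i) ≡ shifted 1 t i
  f-cell t v i v<k i<m = begin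
    f (t * r + v * m + i)                              ≡⟨ cong f (+-assoc (t * r) (v * m) i) ⟩
    f (t * r + (v * m + i))                            ≡⟨ f-shift t (v * m + i) ⟩
    shifted 1 (t + (v * m + i) / r) ((v * m + i) % m)  ≡⟨ cong₂ (shifted 1) quot rem ⟩
    shifted 1 t i                                      ∎
    where
    open ≡-Reasoning
    small : v * m + i < r
    small = ≤-trans (+-monoʳ-< (v * m) i<m)
                    (≤-trans (≤-reflexive (+-comm (v * m) m)) (*-monoˡ-≤ m v<k))
    quot : t + (v * m + i) / r ≡ t
    quot = trans (cong (t +_) (m<n⇒m/n≡0 small)) (+-identityʳ t)
    rem : (v * m + i) % m ≡ i
    rem = trans (cong (_% m) (+-comm (v * m) i))
                (trans ([m+kn]%n≡m%n i v m) (m<n⇒m%n≡m i<m))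

  module Phase (j : ℕ) where
    -- The place of a window of phase j holding the q-th letter of a block; j * n
    -- is −j modulo m.
    place : ℕ → Fin m
    place q = (q + j * n) mod m

    j+jn : ∀ x → (j + x + j * n) % m ≡ x % m
    j+jn x = trans (cong (_% m) (eq j x n)) ([m+kn]%n≡m%n x j m)
      where
      eq : ∀ j x n → j + x + j * n ≡ x + j * suc n
      eq = solve-∀

    place-inverse : ∀ (i : Fin m) → place ((j + toℕ i) % m) ≡ i
    place-inverse i = toℕ-injective (begin
      toℕ (place ((j + toℕ i) % m))          ≡⟨ toℕ-fromℕ< _ ⟩
      ((j + toℕ i) % m + j * n) % m          ≡⟨ %-remove-% (j + toℕ i) (j * n) ⟩
      (j + toℕ i + j * n) % m                ≡⟨ j+jn (toℕ i) ⟩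
      toℕ i % m                              ≡⟨ m<n⇒m%n≡m (toℕ<n i) ⟩
      toℕ i                                  ∎)
      where
      open ≡-Reasoning
      %-remove-% : ∀ x y → (x % m + y) % m ≡ (x + y) % m
      %-remove-% x y = trans (%-distribˡ-+ (x % m) y m)
        (trans (cong (λ z → (z + y % m) % m) (m%n%n≡m%n x m)) (sym (%-distribˡ-+ x y m)))

    place-0 : (j + toℕ (place 0)) % m ≡ 0
    place-0 = begin
      (j + toℕ (place 0)) % m       ≡⟨ cong (λ x → (j + x) % m) (toℕ-fromℕ< _) ⟩
      (j + j * n % m) % m           ≡⟨ %-distribˡ-+ j (j * n % m) m ⟩
      (j % m + j * n % m % m) % m   ≡⟨ cong (λ x → (j % m + x) % m) (m%n%n≡m%n (j * n) m) ⟩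
      (j % m + j * n % m) % m       ≡⟨ %-distribˡ-+ j (j * n) m ⟨
      (j + j * n) % m               ≡⟨ cong (λ x → (x + j * n) % m) (+-identityʳ j) ⟨
      (j + 0 + j * n) % m           ≡⟨ j+jn 0 ⟩
      0                             ∎
      where open ≡-Reasoning

    word : ℕ → B m
    word t = window (cycle n k) m (j + t * r)

    lookup-word : ∀ t i → lookup (word t) i ≡ shifted 1 (t + (j + toℕ i) / r) ((j + toℕ i) % m)
    lookup-word t i = begin
      lookup (word t) i
        ≡⟨ lookup∘tabulate (λ i → lookup (cycle n k) ((j + t * r + toℕ i) mod L)) i ⟩
      lookup (cycle n k) ((j + t * r + toℕ i) mod L)
                                    ≡⟨ lookup-cycle (j + t * r + toℕ i) ⟩
      f (j + t * r + toℕ i)         ≡⟨ cong f (eq j (t * r) (toℕ i)) ⟩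
      f (t * r + (j + toℕ i))       ≡⟨ f-shift t (j + toℕ i) ⟩
      shifted 1 (t + (j + toℕ i) / r) ((j + toℕ i) % m) ∎
      where
      open ≡-Reasoning
      eq : ∀ j x i → j + x + i ≡ x + (j + i)
      eq = solve-∀

    word-0 : ∀ t → lookup (word t) (place 0) ≡ false
    word-0 t = trans (lookup-word t (place 0))
                     (cong (shifted 1 (t + (j + toℕ (place 0)) / r)) place-0)

    word-surjective : ∀ w → lookup w (place 0) ≡ false → ∃[ t ] t < N × w ≡ word t
    word-surjective w w0
      -- The carry `κ d` is the number of block boundaries passed before digit `d` is read.
      with ∃-digits n (λ d → lookup w (place (suc d))) (λ d → (j + toℕ (place (suc d))) / r)
    ... | t , t<N , digits = t , t<N , (begin
      w                            ≡⟨ tabulate∘lookup w ⟨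
      tabulate (lookup w)          ≡⟨ tabulate-cong (λ i → trans (letter i) (sym (lookup-word t i))) ⟩
      tabulate (lookup (word t))   ≡⟨ tabulate∘lookup (word t) ⟩
      word t                       ∎)
      where
      open ≡-Reasoning
      letter : ∀ i → lookup w i ≡ shifted 1 (t + (j + toℕ i) / r) ((j + toℕ i) % m)
      -- `place-inverse` recovers the position from the index of the letter read there, so splitting
      -- on that index separates the leading 0 from the digits.
      letter i with (j + toℕ i) % m | place-inverse i | m%n<n (j + toℕ i) m
      ... | zero  | refl | _       = w0
      ... | suc d | refl | s≤s d<n = sym (digits d d<n)

  phaseWord : ∀ j w → lookup w (Phase.place (toℕ j) 0) ≡ false →
              phaseWords m r (cycle n k) j w
  phaseWord j w w0 with Phase.word-surjective (toℕ j) w w0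
  ... | t , t<N , eq = fromℕ< t<N ,
    trans eq (cong (Phase.word (toℕ j)) (sym (toℕ-fromℕ< t<N)))

  ¬phaseWord : ∀ j w → lookup w (Phase.place (toℕ j) 0) ≡ true →
               phaseWords m r (cycle n k) j w → ⊥
  ¬phaseWord j w w1 (t , refl) with trans (sym w1) (Phase.word-0 (toℕ j) (toℕ t))
  ... | ()

  isMultiversalCycle : IsMultiversalCycle m r (cycle n k)
  -- Once the letter of `w` is abstracted, `lookup-map` gives its negation as the letter of the
  -- complement.
  isMultiversalCycle j w with lookup w (Phase.place (toℕ j) 0) in eq
                            | lookup-map (Phase.place (toℕ j) 0) not w
  ... | false | w̄0 = inj₁ (phaseWord j w eq , ¬phaseWord j (complement w) w̄0)
  ... | true  | w̄0 = inj₂ (¬phaseWord j w eq , phaseWord j (complement w) w̄0)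

-- Executions and time bounds

update-cong : ∀ {x y : Memory} {i v w} → x ≗ y → v ≡ w → (x [ i ≔ v ]) ≗ (y [ i ≔ w ])
update-cong {i = i} x≗y v≡w a with does (a ≟ i)
... | true  = v≡w
... | false = x≗y a

-- Memories are functions, hence compared pointwise.
data _≈_ : Config → Config → Set where
  mem-≗ : ∀ {p o x y} → x ≗ y → ⟨ p , x , o ⟩ ≈ ⟨ p , y , o ⟩

exec-cong : ∀ I {c c′} → c ≈ c′ → exec I c ≈ exec I c′
exec-cong (const i c) (mem-≗ e) = mem-≗ (update-cong e refl)
exec-cong (add i j k) (mem-≗ e) = mem-≗ (update-cong e (cong₂ _+_ (e j) (e k)))
exec-cong (sub i j k) (mem-≗ e) = mem-≗ (update-cong e (cong₂ _∸_ (e j) (e k)))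
exec-cong (load i j) (mem-≗ {x = x} e) =
  mem-≗ (update-cong e (trans (cong x (e j)) (e _)))
exec-cong (store i j) (mem-≗ e) rewrite e i = mem-≗ (update-cong e (e j))
exec-cong (jpos l j) (mem-≗ {x = x} {y} e) with x j | y j | e j
... | zero  | _ | refl = mem-≗ e
... | suc _ | _ | refl = mem-≗ e
exec-cong (print j) (mem-≗ e) rewrite e j = mem-≗ e

run-cong : ∀ {P c c′ d t} → c ≈ c′ → P ⊢ c ⟶[ t ] d → ∃[ d′ ] (P ⊢ c′ ⟶[ t ] d′) × d ≈ d′
run-cong c≈c′ stop = _ , stop , c≈c′
run-cong c≈c′@(mem-≗ _) (step {I = I} fetch run) with run-cong (exec-cong I c≈c′) run
... | d′ , run′ , d≈d′ = d′ , step fetch run′ , d≈d′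

-- Hiding the final configuration and keeping only a time bound allows continuation style: a
-- fragment is verified by assuming that whatever follows it finishes.
Finishes : Program → List ℕ → Config → ℕ → Set
Finishes P o c T = ∃[ d ] ∃[ t ] (P ⊢ c ⟶[ t ] d) × Halted P d × output d ≡ o × t ≤ T

module _ {P : Program} {o : List ℕ} where

  exec-step : ∀ {c I T} → head (drop (pc c) P) ≡ just I →
              Finishes P o (exec I c) T → Finishes P o c (suc T)
  exec-step fetch (d , t , run , h , out , t≤T) =
    d , suc t , step fetch run , h , out , s≤s t≤T

  halt : ∀ {c T} → Halted P c → output c ≡ o → Finishes P o c T
  halt h out = _ , 0 , stop , h , out , z≤n

  weaken : ∀ {c T T′} → T ≤ T′ → Finishes P o c T → Finishes P o c T′
  weaken T≤T′ (d , t , run , h , out , t≤T) = d , t , run , h , out , ≤-trans t≤T T≤T′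

  -- Brings the nested updates left by symbolic execution back to the normal form `memory`, to which
  -- they are only pointwise equal.
  mem-resp : ∀ {p x y o′ T} → y ≗ x → Finishes P o ⟨ p , x , o′ ⟩ T → Finishes P o ⟨ p , y , o′ ⟩ T
  mem-resp y≗x (d , t , run , h , out , t≤T) with run-cong (mem-≗ (sym ∘ y≗x)) run
  ... | d′ , run′ , mem-≗ _ = d′ , t , run′ , h , out , t≤T

-- The program and its memory

-- X₀ = m, X₁ = k, X₂ = 1, X₃ = copies left, X₄ = pointer into the current word,
-- X₅ = letters left, X₆ = current letter, X₇ = 0; the word is stored from X₈ on.
program : Program
program =
    const 2 1
  ∷ add 3 7 1     -- 1: next word
  ∷ const 4 8     -- 2: next copy
  ∷ add 5 7 0
  ∷ load 6 4      -- 4: next letter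
  ∷ print 6
  ∷ add 4 2 4
  ∷ sub 5 5 2
  ∷ jpos 4 5
  ∷ sub 3 3 2
  ∷ jpos 2 3
  ∷ const 4 9     -- 11: increment the word, skipping its leading 0
  ∷ sub 5 0 2
  ∷ jpos 15 5     -- 13: carry into the next digit
  ∷ jpos 23 2     -- overflow: halt
  ∷ load 6 4
  ∷ jpos 19 6
  ∷ store 4 2
  ∷ jpos 1 2
  ∷ store 4 7     -- 19: digit 1 becomes 0 with a carry
  ∷ add 4 2 4
  ∷ sub 5 5 2
  ∷ jpos 13 2
  ∷ []

memory : (m k copies pointer letters letter : ℕ) → (ℕ → Bool) → Memory
memory m k c p l b A 0 = m
memory m k c p l b A 1 = k
memory m k c p l b A 2 = 1
memory m k c p l b A 3 = c
memory m k c p l b A 4 = p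
memory m k c p l b A 5 = l
memory m k c p l b A 6 = b
memory m k c p l b A 7 = 0
memory m k c p l b A (suc (suc (suc (suc (suc (suc (suc (suc a)))))))) = bit (A a)

memory-ext : ∀ {m k c p l b A} {x : Memory} →
  x 0 ≡ m → x 1 ≡ k → x 2 ≡ 1 → x 3 ≡ c → x 4 ≡ p → x 5 ≡ l → x 6 ≡ b → x 7 ≡ 0 →
  (∀ a → x (8 + a) ≡ bit (A a)) → x ≗ memory m k c p l b A
memory-ext e0 e1 e2 e3 e4 e5 e6 e7 eA 0 = e0
memory-ext e0 e1 e2 e3 e4 e5 e6 e7 eA 1 = e1
memory-ext e0 e1 e2 e3 e4 e5 e6 e7 eA 2 = e2
memory-ext e0 e1 e2 e3 e4 e5 e6 e7 eA 3 = e3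
memory-ext e0 e1 e2 e3 e4 e5 e6 e7 eA 4 = e4
memory-ext e0 e1 e2 e3 e4 e5 e6 e7 eA 5 = e5
memory-ext e0 e1 e2 e3 e4 e5 e6 e7 eA 6 = e6
memory-ext e0 e1 e2 e3 e4 e5 e6 e7 eA 7 = e7
memory-ext e0 e1 e2 e3 e4 e5 e6 e7 eA (suc (suc (suc (suc (suc (suc (suc (suc a)))))))) = eA a

-- Removing the lowest digit of `v` from `v * 2 ^ i` leaves a multiple of `2 ^ suc i`; this is the
-- array after a carry.
clear-digit : ∀ i v a →
  (if does (a ≟ i) then 0 else bit (shifted i v a)) ≡ bit (shifted (suc i) ⌊ v /2⌋ a)
clear-digit zero    v zero    = refl
clear-digit zero    v (suc a) = refl
clear-digit (suc i) v zero    = refl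
clear-digit (suc i) v (suc a) = clear-digit i v a

set-digit : ∀ i v a → odd v ≡ false →
  (if does (a ≟ i) then 1 else bit (shifted i v a)) ≡ bit (shifted i (suc v) a)
set-digit zero    v zero    even = cong (bit ∘ not) (sym even)
set-digit zero    v (suc a) even = cong (λ x → bit (digit x a)) (sym (half-suc-even v even))
set-digit (suc i) v zero    even = refl
set-digit (suc i) v (suc a) even = set-digit i v a even

-- Both sides are the digits of `suc v * 2 ^ i`, as `suc v` is twice `suc ⌊ v /2⌋`. A carry thus
-- leaves the target of the increment unchanged.
shifted-carry : ∀ i v → odd v ≡ true → shifted (suc i) (suc ⌊ v /2⌋) ≗ shifted i (suc v)
shifted-carry zero    v v-odd zero    = cong not (sym v-odd)
shifted-carry zero    v v-odd (suc a) = cong (λ x → digit x a) (sym (half-suc-odd v v-odd))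
shifted-carry (suc i) v v-odd zero    = refl
shifted-carry (suc i) v v-odd (suc a) = shifted-carry i v v-odd a

shifted-self : ∀ i v → shifted i v i ≡ odd v
shifted-self zero    v = refl
shifted-self (suc i) v = shifted-self i v

-- Correctness and running time

module Machine (n k′ : ℕ) where
  open Cycle n k′

  k : ℕ
  k = suc k′

  printed : ℕ → List ℕ
  printed = applyUpTo (bit ∘ f)

  Ends : Config → ℕ → Set
  Ends = Finishes program (printed L)

  state : (pc copies pointer letters letter : ℕ) → (ℕ → Bool) → ℕ → Config
  state pc c p l b A q = ⟨ pc , memory m k c p l b A , printed q ⟩

  printed-resp : ∀ {pc x q q′ T} → q ≡ q′ →
    Ends ⟨ pc , x , printed q ⟩ T → Ends ⟨ pc , x , printed q′ ⟩ T
  printed-resp refl ends = ends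

  letters : ∀ {T c base A} → (∀ i → i < m → f (base + i) ≡ A i) →
    (∀ p b → Ends (state 9 c p 0 b A (base + m)) T) →
    ∀ l i b → i + suc l ≡ m → Ends (state 4 c (8 + i) (suc l) b A (base + i)) (suc l * 5 + T)
  letters {T} {c} {base} {A} f≡A next l i b i+l =
    exec-step refl (exec-step refl (exec-step refl (exec-step refl (exec-step refl (rest l i+l)))))
    where
    print-letter : printed (base + i) ++ [ bit (A i) ] ≡ printed (base + suc i)
    print-letter = begin
      printed (base + i) ++ [ bit (A i) ]
        ≡⟨ cong (λ x → printed (base + i) ++ [ bit x ])
                (f≡A i (≤-trans (m<m+n i (s≤s z≤n)) (≤-reflexive i+l))) ⟨
      printed (base + i) ++ [ bit (f (base + i)) ]  ≡⟨ applyUpTo-∷ʳ (bit ∘ f) (base + i) ⟩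
      printed (suc (base + i))                      ≡⟨ cong printed (+-suc base i) ⟨
      printed (base + suc i)                        ∎
      where open ≡-Reasoning
    -- The jump reduces only once the number of remaining letters is split, so it is isolated here.
    rest : ∀ l → i + suc l ≡ m →
      Ends (exec (jpos 4 5)
        ⟨ 8 , (((memory m k c (8 + i) (suc l) b A [ 6 ≔ bit (A i) ]) [ 4 ≔ 9 + i ]) [ 5 ≔ l ])
            , printed (base + i) ++ [ bit (A i) ] ⟩) (l * 5 + T)
    rest zero i+1 rewrite print-letter | trans (+-comm 1 i) i+1 =
      mem-resp (memory-ext refl refl refl refl refl refl refl refl λ _ → refl)
        (next _ _)
    rest (suc l) i+l rewrite print-letter =
      mem-resp (memory-ext refl refl refl refl refl refl refl refl λ _ → refl)
        (letters f≡A next l (suc i) _ (trans (sym (+-suc i (suc l))) i+l))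

  -- `v` copies are done and `u` follow the present one. A copy costs two steps of setup, five per
  -- letter and two for the loop test.
  copies : ∀ {T t} → (∀ p l b → Ends (state 11 0 p l b (shifted 1 t) (t * r + r)) T) →
    ∀ u v p l b → v + suc u ≡ k →
    Ends (state 2 (suc u) p l b (shifted 1 t) (t * r + v * m)) (suc u * (4 + m * 5) + T)
  copies {T} {t} next u v p l b v+u = weaken (≤-reflexive (time (m * 5) (u * (4 + m * 5)) T))
    (exec-step refl (exec-step refl
      (mem-resp (memory-ext refl refl refl refl refl refl refl refl λ _ → refl)
        (printed-resp (+-identityʳ (t * r + v * m))
          (letters (λ i i<m → f-cell t v i (≤-trans (m<m+n v (s≤s z≤n)) (≤-reflexive v+u)) i<m)
            (λ p b → exec-step refl (exec-step refl (rest u v+u p b)))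
            n 0 b refl)))))
    where
    time : ∀ a b T → 2 + (a + (2 + (b + T))) ≡ 4 + a + b + T
    time = solve-∀
    advance : t * r + v * m + m ≡ t * r + suc v * m
    advance = trans (+-assoc (t * r) (v * m) m) (cong (t * r +_) (+-comm (v * m) m))
    rest : ∀ u → v + suc u ≡ k → ∀ p b →
      Ends (exec (jpos 2 3)
        ⟨ 10 , (memory m k (suc u) p 0 b (shifted 1 t) [ 3 ≔ u ]) , printed (t * r + v * m + m) ⟩)
        (u * (4 + m * 5) + T)
    rest zero v+1 p b rewrite advance | suc-injective (trans (+-comm 1 v) v+1) =
      mem-resp (memory-ext refl refl refl refl refl refl refl refl λ _ → refl) (next _ _ _)
    rest (suc u) v+u p b rewrite advance =
      mem-resp (memory-ext refl refl refl refl refl refl refl refl λ _ → refl)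
        (copies next u (suc v) _ _ _ (trans (sym (+-suc v (suc u))) v+u))

  -- Here t = v * 2 ^ i + (2 ^ i ∸ 1), and the lowest i digits of t, all of
  -- them 1, have already been cleared.
  increment : ∀ {T t q} → suc t ≤ N →
    (suc t ≡ N → printed q ≡ printed L) →
    (suc t < N → ∀ p l b → Ends (state 1 0 p l b (shifted 1 (suc t)) q) T) →
    ∀ l i v b → i + l ≡ n → suc v * 2 ^ i ≡ suc t →
    shifted (suc i) (suc v) ≗ shifted 1 (suc t) →
    Ends (state 13 0 (9 + i) l b (shifted (suc i) v) q) (l * 7 + (5 + T))
  -- No digit is left, so `i` is `n` and `suc t` is a positive multiple of `N`: this is the last
  -- round.
  increment {t = t} t<N done next zero i v b i+l val _ =
    exec-step refl (exec-step refl (halt refl (done (≤-antisym t<N N≤t))))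
    where
    N≤t : N ≤ suc t
    N≤t = begin
      2 ^ n           ≡⟨ cong (2 ^_) (trans (sym i+l) (+-identityʳ i)) ⟩
      2 ^ i           ≤⟨ m≤m+n (2 ^ i) (v * 2 ^ i) ⟩
      suc v * 2 ^ i   ≡⟨ val ⟩
      suc t           ∎
      where open ≤-Reasoning
  increment {T} {t} {q} t<N done next (suc l) i v b i+l val goal =
    exec-step refl (exec-step refl (exec-step refl branch))
    where
    x : Memory
    x = memory m k 0 (9 + i) (suc l) b (shifted (suc i) v) [ 6 ≔ bit (shifted i v i) ]
    -- In the last round `suc v` would be `2 ^ suc l`, hence even, whereas here it is odd.
    t≢N : odd v ≡ false → suc t ≢ N
    t≢N even t≡N with trans (sym (odd-double+ (2 ^ l) 0))
                            (trans (cong odd (sym v≡)) (cong not even))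
      where
      double : ∀ x → 2 * x ≡ x + x + 0
      double = solve-∀
      v≡ : suc v ≡ 2 ^ l + 2 ^ l + 0
      v≡ = trans (*-cancelʳ-≡ (suc v) (2 ^ suc l) (2 ^ i) {{m^n≢0 2 i}} (begin
        suc v * 2 ^ i        ≡⟨ val ⟩
        suc t                ≡⟨ t≡N ⟩
        2 ^ n                ≡⟨ cong (2 ^_) (trans (sym i+l) (+-comm i (suc l))) ⟩
        2 ^ (suc l + i)      ≡⟨ ^-distribˡ-+-* 2 (suc l) i ⟩
        2 ^ suc l * 2 ^ i    ∎)) (double (2 ^ l))
        where open ≡-Reasoning
    ... | ()
    branch : Ends (exec (jpos 19 6) ⟨ 16 , x , printed q ⟩) (4 + (l * 7 + (5 + T)))
    branch rewrite shifted-self i v with odd v in eq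
    ... | false = weaken
      (+-monoʳ-≤ 2 (≤-trans (m≤n+m T 5) (≤-trans (m≤n+m (5 + T) (l * 7)) (m≤n+m _ 2))))
      (exec-step refl (exec-step refl
        (mem-resp (memory-ext refl refl refl refl refl refl refl refl
                    λ a → trans (set-digit (suc i) v a eq) (cong bit (goal a)))
          (next (≤∧≢⇒< t<N (t≢N eq)) _ _ _))))
    ... | true = exec-step refl (exec-step refl (exec-step refl (exec-step refl
        (mem-resp (memory-ext refl refl refl refl refl refl refl refl (clear-digit (suc i) v))
          (increment t<N done next l (suc i) ⌊ v /2⌋ 1 (trans (sym (+-suc i l)) i+l)
            (begin
              suc ⌊ v /2⌋ * (2 * 2 ^ i)  ≡⟨ *-assoc (suc ⌊ v /2⌋) 2 (2 ^ i) ⟨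
              suc ⌊ v /2⌋ * 2 * 2 ^ i    ≡⟨ cong (_* 2 ^ i) (suc-odd v eq) ⟨
              suc v * 2 ^ i              ≡⟨ val ⟩
              suc t                      ∎)
            (λ a → trans (shifted-carry (suc i) v eq a) (goal a)))))))
      where open ≡-Reasoning

  -- 17 = 5 + 4 + 8: besides `5 * r`, the term `4 * k` is at most `4 * r`, and `8 + n * 7` is at
  -- most `8 * m`, hence at most `8 * r`. The term added in the proof is the slack.
  round-time : ∀ T → 1 + (k * (4 + m * 5) + (2 + (n * 7 + (5 + T)))) ≤ 17 * r + T
  round-time T = begin
    1 + (k * (4 + m * 5) + (2 + (n * 7 + (5 + T))))  ≤⟨ m≤m+n _ _ ⟩
    1 + (k * (4 + m * 5) + (2 + (n * 7 + (5 + T)))) + (4 * (k * n) + n + 8 * (k′ * m))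
                                                     ≡⟨ eq n k′ T ⟩
    17 * r + T                                       ∎
    where
    open ≤-Reasoning
    eq : ∀ n k T →
      1 + (suc k * (4 + suc n * 5) + (2 + (n * 7 + (5 + T))))
        + (4 * (suc k * n) + n + 8 * (k * suc n))
      ≡ 17 * (suc k * suc n) + T
    eq = solve-∀

  -- The machine has no round counter and stops when the word overflows. `u`, the number of later
  -- rounds, exists only in the proof, as the induction measure.
  rounds : ∀ u t c p l b → t + suc u ≡ N →
    Ends (state 1 c p l b (shifted 1 t) (t * r)) (suc u * (17 * r))
  rounds u t c p l b t+u = weaken (round-time (u * (17 * r)))
    (exec-step refl
      (mem-resp (memory-ext refl refl refl refl refl refl refl refl λ _ → refl)
        (printed-resp (+-identityʳ (t * r))
          (copies (λ p l b → exec-step refl (exec-step refl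
              (mem-resp (memory-ext refl refl refl refl refl refl refl refl λ _ → refl)
                (increment t<N done (next u t+u) n 0 t b refl (*-identityʳ (suc t)) λ _ → refl))))
            k′ 0 p l b refl))))
    where
    t<N : t < N
    t<N = ≤-trans (m<m+n t (s≤s z≤n)) (≤-reflexive t+u)
    done : suc t ≡ N → printed (t * r + r) ≡ printed L
    done t≡N = cong printed (trans (+-comm (t * r) r) (trans (cong (_* r) t≡N) (*-comm N r)))
    next : ∀ u → t + suc u ≡ N → suc t < N → ∀ p l b →
      Ends (state 1 0 p l b (shifted 1 (suc t)) (t * r + r)) (u * (17 * r))
    next zero    t+1 t<N p l b = ⊥-elim (<-irrefl (trans (+-comm 1 t) t+1) t<N)
    next (suc u) t+u _   p l b =
      printed-resp (+-comm r (t * r))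
        (rounds u (suc t) 0 p l b (trans (sym (+-suc t (suc u))) t+u))

  shifted-0 : ∀ i a → shifted i 0 a ≡ false
  shifted-0 zero    zero    = refl
  shifted-0 zero    (suc a) = shifted-0 zero a
  shifted-0 (suc i) zero    = refl
  shifted-0 (suc i) (suc a) = shifted-0 i a

  ends : Ends (start (m ∷ k ∷ [])) (18 * L)
  -- The zeros in memory already form the word of `t = 0`, so setting X₂ is the whole
  -- initialization. This one step is at most `L`, whence 18 = 17 + 1.
  ends = weaken time
    (exec-step refl
      (mem-resp (memory-ext refl refl refl refl refl refl refl refl
                  λ a → cong bit (sym (shifted-0 1 a)))
        (from-0 N refl)))
    where
    from-0 : ∀ N′ → N′ ≡ N → Ends (state 1 0 0 0 0 (shifted 1 0) 0) (N′ * (17 * r))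
    from-0 zero    e = ⊥-elim (<-irrefl e (m^n>0 2 n))
    from-0 (suc u) e = rounds u 0 0 0 0 0 e
    time : suc (N * (17 * r)) ≤ 18 * L
    time = begin
      1 + N * (17 * r)   ≤⟨ +-monoˡ-≤ (N * (17 * r)) (>-nonZero⁻¹ L) ⟩
      L + N * (17 * r)   ≡⟨ eq r N ⟩
      18 * L             ∎
      where
      open ≤-Reasoning
      eq : ∀ r N → r * N + N * (17 * r) ≡ 18 * (r * N)
      eq = solve-∀

  printed-cycle : printed L ≡ map bit (toList (cycle n k′))
  printed-cycle = begin
    printed L                            ≡⟨ map-applyUpTo f bit L ⟨
    map bit (applyUpTo f L)              ≡⟨ cong (map bit) (toList-tabulate L f) ⟨
    map bit (toList (cycle n k′))        ∎
    where open ≡-Reasoning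

theorem16 : ∃[ P ] ∃[ C ] ∀ (m k : ℕ) .{{_ : NonZero m}} .{{_ : NonZero k}} →
    ∃[ S ] ∃[ t ]
    IsMultiversalCycle m (k * m) {{m*n≢0 k m}} S ×
    Generates P (m ∷ k ∷ []) (toList S) t ×
    t ≤ C * cycleLength m (k * m)
theorem16 = program , 18 , λ where
  (suc n) (suc k) → let (d , t , run , halted , out , t≤) = Machine.ends n k in
    cycle n k , t , Cycle.isMultiversalCycle n k ,
    (d , run , halted , trans out (Machine.printed-cycle n k)) , t≤
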